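{- Let $k\ge 2$ be an even integer and let $f:\{0,1\}^d\to\{0,1\}$ be $\varepsilon$-far from linear. If $x_1,\dots,x_k$ are sampled uniformly and independently from $\{0,1\}^d$, then $$\Pr\Big[\sum_{i=1}^k f(x_i)\neq f(x_1\oplus\cdots\oplus x_k)\Big]\ge\varepsilon,$$ where the sum on the left is taken mod 2.
   Context: $\oplus$ denotes bitwise XOR. A function $f:\{0,1\}^d\to\{0,1\}$ is linear if there is $S\subseteq[d]$ with $f(x)=\sum_{i\in S}x[i]\bmod 2$ for all $x$. $f$ is $\varepsilon$-far from linear if $f$ differs from every linear function on at least an $\varepsilon$ fraction of $\{0,1\}^d$. -}

module Defs where

open import Data.Bool.Base using (Bool; true; false; _∧_; _xor_)
open import Data.Bool.Properties using (_≟_)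
open import Data.Fin.Subset using (Subset)
open import Data.Integer.Base using (+_)
open import Data.List.Base using (List; []; _∷_; [_]; length; filter; cartesianProductWith)
open import Data.List.Membership.Propositional using (_∈_)
open import Data.List.Membership.Propositional.Properties using (∈-cartesianProductWith⁺)
open import Data.List.Relation.Unary.All using ([]; _∷_)
open import Data.List.Relation.Unary.AllPairs using ([]; _∷_)
open import Data.List.Relation.Unary.Any using (here; there)
open import Data.List.Relation.Unary.Unique.Propositional using (Unique)
open import Data.List.Relation.Unary.Unique.Propositional.Properties using (cartesianProductWith⁺)
open import Data.Nat.Base using (ℕ; zero; suc; NonZero)
open import Data.Product.Base using (∃-syntax)
open import Data.Rational.Base using (ℚ; _/_; _≤_)
open import Data.Vec.Base using (Vec; []; _∷_; foldr′; replicate; zipWith)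
open import Data.Vec.Properties using (∷-injective)
open import Relation.Binary.PropositionalEquality using (_≡_; refl)
open import Relation.Nullary.Decidable using (¬?)
open import Relation.Unary using (Pred; Decidable)

-- A finite nonempty sample space: every outcome is listed exactly once.
record FiniteSpace (A : Set) : Set where
  field
    outcomes : List A
    complete : ∀ x → x ∈ outcomes
    unique   : Unique outcomes
    point    : A

  length-nonZero : NonZero (length outcomes)
  length-nonZero = nonZero (complete point)
    where
    nonZero : ∀ {x : A} {xs} → x ∈ xs → NonZero (length xs)
    nonZero (here _)  = _
    nonZero (there _) = _

open FiniteSpace

-- Uniform distribution.
Pr : ∀ {A : Set} {p} {P : Pred A p} → FiniteSpace A → Decidable P → ℚ
Pr Ω P? = _/_ (+ length (filter P? (outcomes Ω))) (length (outcomes Ω)) {{length-nonZero Ω}}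

module _ {A : Set} (Ω : FiniteSpace A) where

  vecs : ∀ n → List (Vec A n)
  vecs zero    = [ [] ]
  vecs (suc n) = cartesianProductWith _∷_ (outcomes Ω) (vecs n)

  vecs-complete : ∀ {n} (xs : Vec A n) → xs ∈ vecs n
  vecs-complete []       = here refl
  vecs-complete (x ∷ xs) = ∈-cartesianProductWith⁺ _∷_ (complete Ω x) (vecs-complete xs)

  vecs-unique : ∀ n → Unique (vecs n)
  vecs-unique zero    = [] ∷ []
  vecs-unique (suc n) = cartesianProductWith⁺ _∷_ ∷-injective (unique Ω) (vecs-unique n)

  -- The n-fold product; uniform on it means n independent uniform samples.
  power : ∀ n → FiniteSpace (Vec A n)
  power n = record
    { outcomes = vecs n
    ; complete = vecs-complete
    ; unique   = vecs-unique n
    ; point    = replicate n (point Ω)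
    }

bit : FiniteSpace Bool
bit = record
  { outcomes = false ∷ true ∷ []
  ; complete = λ { false → here refl ; true → there (here refl) }
  ; unique   = ((λ ()) ∷ []) ∷ [] ∷ []
  ; point    = false
  }

Cube : ℕ → Set
Cube d = Vec Bool d

cube : ∀ d → FiniteSpace (Cube d)
cube d = power bit d

infixl 6 _⊕_

_⊕_ : ∀ {d} → Cube d → Cube d → Cube d
_⊕_ = zipWith _xor_

⨁ : ∀ {d k} → Vec (Cube d) k → Cube d
⨁ {d} = foldr′ _⊕_ (replicate d false)

-- Sum mod 2 (false = 0, true = 1).
sum₂ : ∀ {n} → Vec Bool n → Bool
sum₂ = foldr′ _xor_ false

-- The sum mod 2 of x[i] over i ∈ S; a Subset is its indicator vector.
sumOver : ∀ {d} → Subset d → Cube d → Bool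
sumOver S x = sum₂ (zipWith _∧_ S x)

Linear : ∀ {d} → (Cube d → Bool) → Set
Linear {d} f = ∃[ S ] (∀ x → f x ≡ sumOver {d} S x)

FarFromLinear : ∀ {d} → ℚ → (Cube d → Bool) → Set
FarFromLinear {d} ε f = ∀ (g : Cube d → Bool) → Linear g → ε ≤ Pr (cube d) (λ x → ¬? (f x ≟ g x))

{-# OPTIONS --safe #-}

-- Put F = (-1)^f, N = 2^d and let G(S) = ∑ₓ F(x) χ_S(x) be the unnormalised
-- Fourier coefficients.  The number of accepted minus the number of rejected
-- k-tuples is X with N X = ∑_S G(S)^(k+1), and Parseval reads ∑_S G(S)² = N².
-- Writing β = 1 - 2ε, being ε-far says G(S) ≤ β N for every S, so for even k
-- N X ≤ β N ∑_S G(S)^k, and it remains to compare ∑_S G(S)^k with N^k.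
-- If β ≥ 0, then ∑_S G(S)^k ≤ N^k by |G| ≤ N and Parseval.  If β < 0, then
-- every G(S) is negative; combining Parseval with ∑_S G(S) = N F(0) ≥ -N gives
-- ∑_S G(S) (G(S) + N) ≥ 0 with all terms ≤ 0, hence every G(S) is -N and
-- ∑_S G(S)^k ≥ N^k.
module Submission where

open import Defs
open import Algebra.Properties.CommutativeSemigroup using (interchange; x∙yz≈y∙xz)
open import Data.Bool.Base using (Bool; true; false; _∧_; _xor_)
open import Data.Bool.Properties using (_≟_; ∧-zeroʳ; ∧-identityʳ; ∧-distribˡ-xor; xor-assoc; xor-identityˡ; xor-identityʳ)
open import Data.Fin.Subset using (Subset)
open import Data.Integer.Base as ℤ using (ℤ; +_; 0ℤ; 1ℤ; -1ℤ; _+_; _*_; _-_; -_; _^_; Positive)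
open import Data.Integer.Properties as ℤ using (module ≤-Reasoning)
open import Data.Integer.Tactic.RingSolver using (solve-∀)
open import Data.List.Base as List using (List; []; _∷_; _++_; length; filter; cartesianProductWith)
open import Data.List.Membership.Propositional using (_∈_)
open import Data.List.Relation.Unary.Any using (here; there)
open import Data.Nat.Base as ℕ using (ℕ; zero; suc)
open import Data.Nat.Divisibility using (_∣_; divides)
open import Data.Product.Base using (_,_)
open import Data.Rational.Base using (ℚ; _≤_; _/_; ↥_; ↧_)
open import Data.Rational.Properties using (toℚᵘ-mono-≤; toℚᵘ-cancel-≤; toℚᵘ-fromℚᵘ)
open import Data.Rational.Unnormalised.Base as ℚᵘ using (mkℚᵘ)
open import Data.Rational.Unnormalised.Properties as ℚᵘ using ()
open import Data.Vec.Base using ([]; _∷_; map; replicate)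
open import Data.Vec.Properties using (zipWith-assoc; zipWith-identityˡ; zipWith-identityʳ)
open import Relation.Binary.PropositionalEquality using (_≡_; refl; sym; trans; cong; cong₂; subst; module ≡-Reasoning)
open import Relation.Nullary.Decidable using (yes; no; ¬?)

open FiniteSpace

private
  variable
    A B C : Set

  +-interchange = interchange ℤ.+-commutativeSemigroup
  *-interchange = interchange ℤ.*-commutativeSemigroup
  *-exchange    = x∙yz≈y∙xz ℤ.*-commutativeSemigroup

-- Finite sums of integers

∑ : List A → (A → ℤ) → ℤ
∑ []       g = 0ℤ
∑ (x ∷ xs) g = g x + ∑ xs g

∑-cong : ∀ (xs : List A) {g h : A → ℤ} → (∀ x → g x ≡ h x) → ∑ xs g ≡ ∑ xs h
∑-cong []       eq = refl
∑-cong (x ∷ xs) eq = cong₂ _+_ (eq x) (∑-cong xs eq)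

∑-mono-≤ : ∀ (xs : List A) {g h : A → ℤ} → (∀ x → g x ℤ.≤ h x) → ∑ xs g ℤ.≤ ∑ xs h
∑-mono-≤ []       le = ℤ.≤-refl
∑-mono-≤ (x ∷ xs) le = ℤ.+-mono-≤ (le x) (∑-mono-≤ xs le)

∑-+ : ∀ (xs : List A) (g h : A → ℤ) → ∑ xs (λ x → g x + h x) ≡ ∑ xs g + ∑ xs h
∑-+ []       g h = refl
∑-+ (x ∷ xs) g h = trans (cong (_+_ (g x + h x)) (∑-+ xs g h)) (+-interchange (g x) (h x) (∑ xs g) (∑ xs h))

∑-*ˡ : ∀ (xs : List A) a (g : A → ℤ) → ∑ xs (λ x → a * g x) ≡ a * ∑ xs g
∑-*ˡ []       a g = sym (ℤ.*-zeroʳ a)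
∑-*ˡ (x ∷ xs) a g = trans (cong (_+_ (a * g x)) (∑-*ˡ xs a g)) (sym (ℤ.*-distribˡ-+ a (g x) (∑ xs g)))

∑-const : ∀ (xs : List A) a → ∑ xs (λ _ → a) ≡ + length xs * a
∑-const []       a = refl
∑-const (x ∷ xs) a = trans (cong (_+_ a) (∑-const xs a)) (sym (ℤ.suc-* (+ length xs) a))

∑-zero : ∀ (xs : List A) → ∑ xs (λ _ → 0ℤ) ≡ 0ℤ
∑-zero xs = trans (∑-const xs 0ℤ) (ℤ.*-zeroʳ (+ length xs))

∑-swap : ∀ (xs : List A) (ys : List B) (g : A → B → ℤ) →
  ∑ xs (λ x → ∑ ys (g x)) ≡ ∑ ys (λ y → ∑ xs (λ x → g x y))
∑-swap []       ys g = sym (∑-zero ys)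
∑-swap (x ∷ xs) ys g =
  trans (cong (_+_ (∑ ys (g x))) (∑-swap xs ys g)) (sym (∑-+ ys (g x) (λ y → ∑ xs (λ x → g x y))))

∑-++ : ∀ (xs ys : List A) g → ∑ (xs ++ ys) g ≡ ∑ xs g + ∑ ys g
∑-++ []       ys g = sym (ℤ.+-identityˡ (∑ ys g))
∑-++ (x ∷ xs) ys g = trans (cong (_+_ (g x)) (∑-++ xs ys g)) (sym (ℤ.+-assoc (g x) (∑ xs g) (∑ ys g)))

∑-map : ∀ (xs : List A) (h : A → B) g → ∑ (List.map h xs) g ≡ ∑ xs (λ x → g (h x))
∑-map []       h g = refl
∑-map (x ∷ xs) h g = cong (_+_ (g (h x))) (∑-map xs h g)

∑-cartesianProductWith : ∀ (c : A → B → C) xs ys g →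
  ∑ (cartesianProductWith c xs ys) g ≡ ∑ xs (λ x → ∑ ys (λ y → g (c x y)))
∑-cartesianProductWith c []       ys g = refl
∑-cartesianProductWith c (x ∷ xs) ys g =
  trans (∑-++ (List.map (c x) ys) (cartesianProductWith c xs ys) g)
        (cong₂ _+_ (∑-map ys (c x) g) (∑-cartesianProductWith c xs ys g))

∑-nonNeg : ∀ (xs : List A) {g : A → ℤ} → (∀ x → 0ℤ ℤ.≤ g x) → 0ℤ ℤ.≤ ∑ xs g
∑-nonNeg xs {g} g≥0 = subst (ℤ._≤ ∑ xs g) (∑-zero xs) (∑-mono-≤ xs g≥0)

term≤∑ : ∀ {xs : List A} {x} {g : A → ℤ} → (∀ x → 0ℤ ℤ.≤ g x) → x ∈ xs → g x ℤ.≤ ∑ xs g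
term≤∑ {xs = x ∷ xs} {g = g} g≥0 (here refl) =
  subst (ℤ._≤ g x + ∑ xs g) (ℤ.+-identityʳ (g x)) (ℤ.+-monoʳ-≤ (g x) (∑-nonNeg xs g≥0))
term≤∑ {xs = y ∷ xs} {x} {g} g≥0 (there x∈xs) =
  subst (ℤ._≤ g y + ∑ xs g) (ℤ.+-identityˡ (g x)) (ℤ.+-mono-≤ (g≥0 y) (term≤∑ g≥0 x∈xs))

-- Serves twice: for `bit` it yields the doubling of `card`, and for `cube d` it turns the number of
-- k-tuples into `card d ^ k`.
length-vecs : ∀ (Ω : FiniteSpace A) n → + length (vecs Ω n) ≡ (+ length (outcomes Ω)) ^ n
length-vecs Ω zero    = refl
length-vecs Ω (suc n) = begin
  + length (vecs Ω (suc n))                          ≡⟨ ∑-1 (vecs Ω (suc n)) ⟨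
  ∑ (vecs Ω (suc n)) (λ _ → 1ℤ)                      ≡⟨ ∑-cartesianProductWith _∷_ (outcomes Ω) (vecs Ω n) (λ _ → 1ℤ) ⟩
  ∑ (outcomes Ω) (λ _ → ∑ (vecs Ω n) (λ _ → 1ℤ))     ≡⟨ ∑-const (outcomes Ω) _ ⟩
  + length (outcomes Ω) * ∑ (vecs Ω n) (λ _ → 1ℤ)    ≡⟨ cong (+ length (outcomes Ω) *_) (trans (∑-1 (vecs Ω n)) (length-vecs Ω n)) ⟩
  + length (outcomes Ω) * (+ length (outcomes Ω)) ^ n ∎
  where
  open ≡-Reasoning
  ∑-1 : ∀ {A : Set} (xs : List A) → ∑ xs (λ _ → 1ℤ) ≡ + length xs
  ∑-1 xs = trans (∑-const xs 1ℤ) (ℤ.*-identityʳ (+ length xs))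

-- Integer inequalities

square-nonNeg : ∀ i → 0ℤ ℤ.≤ i * i
square-nonNeg (+ n)      = subst (0ℤ ℤ.≤_) (ℤ.pos-* n n) (ℤ.+≤+ ℕ.z≤n)
square-nonNeg ℤ.-[1+ n ] = ℤ.+≤+ ℕ.z≤n

-- Powers of a square are visibly nonnegative and monotone, so no case split on the sign of `i` is
-- needed. The exponent has the shape that `divides` supplies.
^-even : ∀ i m → i ^ (m ℕ.* 2) ≡ (i * i) ^ m
^-even i zero    = refl
^-even i (suc m) = trans (sym (ℤ.*-assoc i i (i ^ (m ℕ.* 2)))) (cong ((i * i) *_) (^-even i m))

*-mono-≤-nonNeg : ∀ {a b c d} → 0ℤ ℤ.≤ b → 0ℤ ℤ.≤ c → a ℤ.≤ b → c ℤ.≤ d → a * c ℤ.≤ b * d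
*-mono-≤-nonNeg {b = b} {c = c} b≥0 c≥0 a≤b c≤d =
  ℤ.≤-trans (ℤ.*-monoʳ-≤-nonNeg c {{ℤ.nonNegative c≥0}} a≤b)
            (ℤ.*-monoˡ-≤-nonNeg b {{ℤ.nonNegative b≥0}} c≤d)

*-nonNeg : ∀ {a b} → 0ℤ ℤ.≤ a → 0ℤ ℤ.≤ b → 0ℤ ℤ.≤ a * b
*-nonNeg a≥0 b≥0 = *-mono-≤-nonNeg a≥0 ℤ.≤-refl a≥0 b≥0

^-nonNeg : ∀ {a} → 0ℤ ℤ.≤ a → ∀ m → 0ℤ ℤ.≤ a ^ m
^-nonNeg a≥0 zero    = ℤ.+≤+ ℕ.z≤n
^-nonNeg a≥0 (suc m) = *-nonNeg a≥0 (^-nonNeg a≥0 m)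

^-monoˡ-≤-nonNeg : ∀ {a b} → 0ℤ ℤ.≤ a → a ℤ.≤ b → ∀ m → a ^ m ℤ.≤ b ^ m
^-monoˡ-≤-nonNeg a≥0 a≤b zero    = ℤ.≤-refl
^-monoˡ-≤-nonNeg a≥0 a≤b (suc m) =
  *-mono-≤-nonNeg (ℤ.≤-trans a≥0 a≤b) (^-nonNeg a≥0 m) a≤b (^-monoˡ-≤-nonNeg a≥0 a≤b m)

-- The quotient `+ c / n` is reduced to lowest terms, so its numerator need not be `c`. Passing to
-- unnormalised rationals makes the comparison a plain cross-multiplication.
≤-/⁻ : ∀ {ε} c n .{{_ : ℕ.NonZero n}} → ε ≤ (+ c / n) → ↥ ε * + n ℤ.≤ + c * ↧ ε
≤-/⁻ {ε@record{}} c (suc n) le =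
  ℚᵘ.drop-*≤* (ℚᵘ.≤-respʳ-≃ (toℚᵘ-fromℚᵘ (mkℚᵘ (+ c) n)) (toℚᵘ-mono-≤ le))

≤-/⁺ : ∀ {ε} c n .{{_ : ℕ.NonZero n}} → ↥ ε * + n ℤ.≤ + c * ↧ ε → ε ≤ (+ c / n)
≤-/⁺ {ε@record{}} c (suc n) le =
  toℚᵘ-cancel-≤ (ℚᵘ.≤-respʳ-≃ (ℚᵘ.≃-sym (toℚᵘ-fromℚᵘ (mkℚᵘ (+ c) n))) (ℚᵘ.*≤* le))

-- Signs and characters

sign : Bool → ℤ
sign false = 1ℤ
sign true  = -1ℤ

sign-xor : ∀ a b → sign (a xor b) ≡ sign a * sign b
sign-xor false b     = sym (ℤ.*-identityˡ (sign b))
sign-xor true  false = refl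
sign-xor true  true  = refl

sign-square : ∀ b → sign b * sign b ≡ 1ℤ
sign-square false = refl
sign-square true  = refl

-1≤sign : ∀ b → -1ℤ ℤ.≤ sign b
-1≤sign false = ℤ.-≤+
-1≤sign true  = ℤ.≤-refl

-- Disagreement counts as sums of signs

private
  count-agree : ∀ n c → 1ℤ + (n - + 2 * c) ≡ 1ℤ + n - + 2 * c
  count-agree = solve-∀
  count-differ : ∀ n c → -1ℤ + (n - + 2 * c) ≡ 1ℤ + n - + 2 * (1ℤ + c)
  count-differ = solve-∀

disagreements : List A → (A → Bool) → (A → Bool) → ℕ
disagreements xs a b = length (filter (λ x → ¬? (a x ≟ b x)) xs)

∑-sign-xor : ∀ (xs : List A) (a b : A → Bool) →
  ∑ xs (λ x → sign (a x xor b x)) ≡ + length xs - + 2 * + disagreements xs a b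
∑-sign-xor []       a b = refl
∑-sign-xor (x ∷ xs) a b with a x | b x | ∑-sign-xor xs a b
... | false | false | ih = trans (cong (_+_ 1ℤ) ih) (count-agree (+ length xs) (+ disagreements xs a b))
... | true  | true  | ih = trans (cong (_+_ 1ℤ) ih) (count-agree (+ length xs) (+ disagreements xs a b))
... | false | true  | ih = trans (cong (_+_ -1ℤ) ih) (count-differ (+ length xs) (+ disagreements xs a b))
... | true  | false | ih = trans (cong (_+_ -1ℤ) ih) (count-differ (+ length xs) (+ disagreements xs a b))

module _ (Ω : FiniteSpace A) (a b : A → Bool) (ε : ℚ) where
  private
    n = + length (outcomes Ω)
    c = + disagreements (outcomes Ω) a b

    -- With ε = p/q, the slack in the correlation bound is twice the slack in the cross-multiplied
    -- probability bound. This one identity gives both directions of the translation; `q - + 2 * p`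
    -- is 1 - 2ε with its denominator cleared.
    gap : ∀ p q n c → (q - + 2 * p) * n - q * (n - + 2 * c) ≡ + 2 * (c * q - p * n)
    gap = solve-∀

    gap′ : (↧ ε - + 2 * ↥ ε) * n - ↧ ε * ∑ (outcomes Ω) (λ x → sign (a x xor b x)) ≡ + 2 * (c * ↧ ε - ↥ ε * n)
    gap′ = trans (cong (λ z → (↧ ε - + 2 * ↥ ε) * n - ↧ ε * z) (∑-sign-xor (outcomes Ω) a b)) (gap (↥ ε) (↧ ε) n c)

  ≤Pr⇒correlation≤ : ε ≤ Pr Ω (λ x → ¬? (a x ≟ b x)) →
    ↧ ε * ∑ (outcomes Ω) (λ x → sign (a x xor b x)) ℤ.≤ (↧ ε - + 2 * ↥ ε) * n
  ≤Pr⇒correlation≤ le = ℤ.0≤i-j⇒j≤i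
    (subst (0ℤ ℤ.≤_) (sym gap′)
      (*-nonNeg {+ 2} (ℤ.+≤+ ℕ.z≤n) (ℤ.i≤j⇒0≤j-i (≤-/⁻ (disagreements (outcomes Ω) a b) (length (outcomes Ω)) {{length-nonZero Ω}} le))))

  correlation≤⇒≤Pr : ↧ ε * ∑ (outcomes Ω) (λ x → sign (a x xor b x)) ℤ.≤ (↧ ε - + 2 * ↥ ε) * n →
    ε ≤ Pr Ω (λ x → ¬? (a x ≟ b x))
  correlation≤⇒≤Pr le = ≤-/⁺ (disagreements (outcomes Ω) a b) (length (outcomes Ω)) {{length-nonZero Ω}}
    (ℤ.0≤i-j⇒j≤i (ℤ.*-cancelˡ-≤-pos 0ℤ _ (+ 2) (subst (0ℤ ℤ.≤_) gap′ (ℤ.i≤j⇒0≤j-i le))))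

-- The Walsh characters of the cube.
χ : ∀ {d} → Subset d → Cube d → ℤ
χ S x = sign (sumOver S x)

χ-∷ : ∀ {d} c (S : Subset d) b x → χ (c ∷ S) (b ∷ x) ≡ sign (c ∧ b) * χ S x
χ-∷ c S b x = sign-xor (c ∧ b) (sumOver S x)

χ-⊕ : ∀ {d} (S : Subset d) x y → χ S (x ⊕ y) ≡ χ S x * χ S y
χ-⊕ []      []      []      = refl
χ-⊕ (c ∷ S) (a ∷ x) (b ∷ y) = begin
  χ (c ∷ S) ((a ∷ x) ⊕ (b ∷ y))                         ≡⟨ χ-∷ c S (a xor b) (x ⊕ y) ⟩
  sign (c ∧ (a xor b)) * χ S (x ⊕ y)                    ≡⟨ cong₂ _*_ (trans (cong sign (∧-distribˡ-xor c a b)) (sign-xor (c ∧ a) (c ∧ b))) (χ-⊕ S x y) ⟩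
  sign (c ∧ a) * sign (c ∧ b) * (χ S x * χ S y)         ≡⟨ *-interchange (sign (c ∧ a)) (sign (c ∧ b)) (χ S x) (χ S y) ⟩
  sign (c ∧ a) * χ S x * (sign (c ∧ b) * χ S y)         ≡⟨ cong₂ _*_ (χ-∷ c S a x) (χ-∷ c S b y) ⟨
  χ (c ∷ S) (a ∷ x) * χ (c ∷ S) (b ∷ y)                 ∎
  where
  open ≡-Reasoning

χ-zero : ∀ {d} (S : Subset d) → χ S (replicate d false) ≡ 1ℤ
χ-zero []      = refl
χ-zero (c ∷ S) = trans (χ-∷ c S false _) (cong₂ _*_ (cong sign (∧-zeroʳ c)) (χ-zero S))

-- Fourier inversion

card : ℕ → ℤ
card d = + length (vecs bit d)

∑-cube-suc : ∀ {d} (g : Cube (suc d) → ℤ) →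
  ∑ (vecs bit (suc d)) g ≡ ∑ (vecs bit d) (λ x → g (false ∷ x)) + ∑ (vecs bit d) (λ x → g (true ∷ x))
∑-cube-suc {d} g =
  trans (∑-cartesianProductWith _∷_ (outcomes bit) (vecs bit d) g)
        (cong (_+_ (∑ (vecs bit d) (λ x → g (false ∷ x)))) (ℤ.+-identityʳ _))

card-suc : ∀ d → card (suc d) ≡ + 2 * card d
card-suc d = trans (length-vecs bit (suc d)) (cong (+ 2 *_) (sym (length-vecs bit d)))

-- Left unnormalised so that all values stay integers; the missing factor `card d` reappears in
-- `inversion`.
transform : ∀ {d} → (Cube d → ℤ) → Subset d → ℤ
transform {d} h S = ∑ (vecs bit d) (λ x → h x * χ S x)

transform-∷ : ∀ {d} (h : Cube (suc d) → ℤ) c S →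
  transform h (c ∷ S) ≡ transform (λ x → h (false ∷ x)) S + sign c * transform (λ x → h (true ∷ x)) S
transform-∷ {d} h c S = trans (∑-cube-suc (λ x → h x * χ (c ∷ S) x)) (cong₂ _+_
  (∑-cong (vecs bit d) (λ x → cong (h (false ∷ x) *_)
    (trans (χ-∷ c S false x) (trans (cong (λ b → sign b * χ S x) (∧-zeroʳ c)) (ℤ.*-identityˡ (χ S x))))))
  (trans
    (∑-cong (vecs bit d) (λ x → trans
      (cong (h (true ∷ x) *_) (trans (χ-∷ c S true x) (cong (λ b → sign b * χ S x) (∧-identityʳ c))))
      (*-exchange (h (true ∷ x)) (sign c) (χ S x))))
    (∑-*ˡ (vecs bit d) (sign c) (λ x → h (true ∷ x) * χ S x))))

-- Induction on the dimension takes the place of orthogonality of the characters: the two choices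
-- for the first bit of `S` together isolate the half of `h` selected by `b`, and each coordinate
-- contributes a factor 2 to `card d`.
inversion : ∀ {d} (h : Cube d → ℤ) y → ∑ (vecs bit d) (λ S → χ S y * transform h S) ≡ card d * h y
inversion {zero}  h []      = unit (h [])
  where
  unit : ∀ a → 1ℤ * (a * 1ℤ + 0ℤ) + 0ℤ ≡ 1ℤ * a
  unit = solve-∀
inversion {suc d} h (b ∷ y) = begin
  ∑ (vecs bit (suc d)) term
    ≡⟨ ∑-cube-suc term ⟩
  ∑ (vecs bit d) (λ S → term (false ∷ S)) + ∑ (vecs bit d) (λ S → term (true ∷ S))
    ≡⟨ ∑-+ (vecs bit d) (λ S → term (false ∷ S)) (λ S → term (true ∷ S)) ⟨
  ∑ (vecs bit d) (λ S → term (false ∷ S) + term (true ∷ S))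
    ≡⟨ ∑-cong (vecs bit d) fold ⟩
  ∑ (vecs bit d) (λ S → + 2 * (χ S y * transform (λ x → h (b ∷ x)) S))
    ≡⟨ ∑-*ˡ (vecs bit d) (+ 2) _ ⟩
  + 2 * ∑ (vecs bit d) (λ S → χ S y * transform (λ x → h (b ∷ x)) S)
    ≡⟨ cong (+ 2 *_) (inversion (λ x → h (b ∷ x)) y) ⟩
  + 2 * (card d * h (b ∷ y))
    ≡⟨ ℤ.*-assoc (+ 2) (card d) (h (b ∷ y)) ⟨
  + 2 * card d * h (b ∷ y)
    ≡⟨ cong (_* h (b ∷ y)) (card-suc d) ⟨
  card (suc d) * h (b ∷ y) ∎
  where
  open ≡-Reasoning

  term : Subset (suc d) → ℤ
  term S = χ S (b ∷ y) * transform h S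

  -- Here `t` stands for the transforms of the two halves of `h`: their sum plus `sign b` times
  -- their difference is twice `t b`. The literal signs are those left by unfolding `χ-∷` and
  -- `transform-∷`.
  combine : ∀ b u (t : Bool → ℤ) →
    1ℤ * u * (t false + 1ℤ * t true) + sign b * u * (t false + -1ℤ * t true) ≡ + 2 * (u * t b)
  combine false u t = lemma u (t false) (t true)
    where
    lemma : ∀ u t₀ t₁ → 1ℤ * u * (t₀ + 1ℤ * t₁) + 1ℤ * u * (t₀ + -1ℤ * t₁) ≡ + 2 * (u * t₀)
    lemma = solve-∀
  combine true  u t = lemma u (t false) (t true)
    where
    lemma : ∀ u t₀ t₁ → 1ℤ * u * (t₀ + 1ℤ * t₁) + -1ℤ * u * (t₀ + -1ℤ * t₁) ≡ + 2 * (u * t₁)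
    lemma = solve-∀

  fold : ∀ S → term (false ∷ S) + term (true ∷ S) ≡ + 2 * (χ S y * transform (λ x → h (b ∷ x)) S)
  fold S = trans
    (cong₂ _+_ (cong₂ _*_ (χ-∷ false S b y) (transform-∷ h false S))
               (cong₂ _*_ (χ-∷ true S b y) (transform-∷ h true S)))
    (combine b (χ S y) (λ b → transform (λ x → h (b ∷ x)) S))

-- Fourier expansion of the k-query test

module _ {d : ℕ} (f : Cube d → Bool) where

  private
    N = card d
    𝟎 = replicate d false

  F : Cube d → ℤ
  F x = sign (f x)

  G : Subset d → ℤ
  G = transform F

  -- In this form `G S` is agreements minus disagreements of `f` with the linear function of `S`,
  -- which is what farness controls.
  G≡correlation : ∀ S → G S ≡ ∑ (vecs bit d) (λ x → sign (f x xor sumOver S x))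
  G≡correlation S = ∑-cong (vecs bit d) (λ x → sym (sign-xor (f x) (sumOver S x)))

  -N≤G : ∀ S → - N ℤ.≤ G S
  -N≤G S = begin
    - N                                                   ≡⟨ ℤ.-1*i≡-i N ⟨
    -1ℤ * N                                               ≡⟨ ℤ.*-comm -1ℤ N ⟩
    N * -1ℤ                                               ≡⟨ ∑-const (vecs bit d) -1ℤ ⟨
    ∑ (vecs bit d) (λ _ → -1ℤ)                            ≤⟨ ∑-mono-≤ (vecs bit d) (λ x → -1≤sign (f x xor sumOver S x)) ⟩
    ∑ (vecs bit d) (λ x → sign (f x xor sumOver S x))     ≡⟨ G≡correlation S ⟨
    G S                                                   ∎
    where open ≤-Reasoning

  -- Shifting the argument by y makes the sum amenable to induction on k.
  testSum : ℕ → Cube d → ℤ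
  testSum k y = ∑ (vecs (cube d) k) (λ xs → sign (sum₂ (map f xs) xor f (y ⊕ ⨁ xs)))

  testSum-zero : ∀ y → testSum 0 y ≡ F (y ⊕ 𝟎)
  testSum-zero y = ℤ.+-identityʳ _

  -- The first sample `x` leaves `F x` as a factor and is absorbed into the shift by associativity
  -- of `⊕`.
  testSum-suc : ∀ k y → testSum (suc k) y ≡ ∑ (vecs bit d) (λ x → F x * testSum k (y ⊕ x))
  testSum-suc k y = trans
    (∑-cartesianProductWith _∷_ (vecs bit d) (vecs (cube d) k) _)
    (∑-cong (vecs bit d) (λ x → trans
      (∑-cong (vecs (cube d) k) (λ xs → trans
        (cong sign (trans (xor-assoc (f x) (sum₂ (map f xs)) (f (y ⊕ (x ⊕ ⨁ xs))))
          (cong (λ z → f x xor (sum₂ (map f xs) xor f z)) (sym (zipWith-assoc xor-assoc y x (⨁ xs))))))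
        (sign-xor (f x) _)))
      (∑-*ˡ (vecs (cube d) k) (F x) _)))

  -- `testSum k` is a convolution of `k + 1` copies of `F`, one per sample and one for the query at
  -- the sum, so its transform is a power of `G`. The base case is inversion; in the step `χ-⊕`
  -- separates `y` from `x`, and after swapping the sums the one over `x` is a further factor `G S`.
  N*testSum : ∀ k y → N * testSum k y ≡ ∑ (vecs bit d) (λ S → χ S y * G S ^ suc k)
  N*testSum zero y = begin
    N * testSum 0 y                               ≡⟨ cong (N *_) (trans (testSum-zero y) (cong F (zipWith-identityʳ xor-identityʳ y))) ⟩
    N * F y                                       ≡⟨ inversion F y ⟨
    ∑ (vecs bit d) (λ S → χ S y * G S)            ≡⟨ ∑-cong (vecs bit d) (λ S → cong (χ S y *_) (sym (ℤ.^-identityʳ (G S)))) ⟩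
    ∑ (vecs bit d) (λ S → χ S y * G S ^ 1)        ∎
    where open ≡-Reasoning
  N*testSum (suc k) y = begin
    N * testSum (suc k) y
      ≡⟨ cong (N *_) (testSum-suc k y) ⟩
    N * ∑ (vecs bit d) (λ x → F x * testSum k (y ⊕ x))
      ≡⟨ ∑-*ˡ (vecs bit d) N _ ⟨
    ∑ (vecs bit d) (λ x → N * (F x * testSum k (y ⊕ x)))
      ≡⟨ ∑-cong (vecs bit d) expand ⟩
    ∑ (vecs bit d) (λ x → ∑ (vecs bit d) (λ S → χ S y * G S ^ suc k * (F x * χ S x)))
      ≡⟨ ∑-swap (vecs bit d) (vecs bit d) _ ⟩
    ∑ (vecs bit d) (λ S → ∑ (vecs bit d) (λ x → χ S y * G S ^ suc k * (F x * χ S x)))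
      ≡⟨ ∑-cong (vecs bit d) (λ S → trans (∑-*ˡ (vecs bit d) (χ S y * G S ^ suc k) _) (regroup (χ S y) (G S ^ suc k) (G S))) ⟩
    ∑ (vecs bit d) (λ S → χ S y * G S ^ suc (suc k)) ∎
    where
    open ≡-Reasoning
    regroup : ∀ a b c → a * b * c ≡ a * (c * b)
    regroup = solve-∀
    shuffle : ∀ a b c e → a * (b * c * e) ≡ b * e * (a * c)
    shuffle = solve-∀
    expand : ∀ x → N * (F x * testSum k (y ⊕ x)) ≡ ∑ (vecs bit d) (λ S → χ S y * G S ^ suc k * (F x * χ S x))
    expand x = begin
      N * (F x * testSum k (y ⊕ x))
        ≡⟨ *-exchange N (F x) _ ⟩
      F x * (N * testSum k (y ⊕ x))
        ≡⟨ cong (F x *_) (N*testSum k (y ⊕ x)) ⟩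
      F x * ∑ (vecs bit d) (λ S → χ S (y ⊕ x) * G S ^ suc k)
        ≡⟨ ∑-*ˡ (vecs bit d) (F x) _ ⟨
      ∑ (vecs bit d) (λ S → F x * (χ S (y ⊕ x) * G S ^ suc k))
        ≡⟨ ∑-cong (vecs bit d) (λ S → trans (cong (λ z → F x * (z * G S ^ suc k)) (χ-⊕ S y x)) (shuffle (F x) (χ S y) (χ S x) (G S ^ suc k))) ⟩
      ∑ (vecs bit d) (λ S → χ S y * G S ^ suc k * (F x * χ S x)) ∎

  N*testSum-𝟎 : ∀ k → N * testSum k 𝟎 ≡ ∑ (vecs bit d) (λ S → G S ^ suc k)
  N*testSum-𝟎 k = trans (N*testSum k 𝟎) (∑-cong (vecs bit d) (λ S →
    trans (cong (_* G S ^ suc k) (χ-zero S)) (ℤ.*-identityˡ (G S ^ suc k))))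

  -- Parseval and even power sums of the coefficients

  ∑G : ∑ (vecs bit d) G ≡ N * F 𝟎
  ∑G = trans (∑-cong (vecs bit d) (λ S → sym (trans (cong (_* G S) (χ-zero S)) (ℤ.*-identityˡ (G S)))))
             (inversion F 𝟎)

  parseval : ∑ (vecs bit d) (λ S → G S * G S) ≡ N * N
  parseval = begin
    ∑ (vecs bit d) (λ S → G S * G S)        ≡⟨ ∑-cong (vecs bit d) (λ S → cong (G S *_) (sym (ℤ.^-identityʳ (G S)))) ⟩
    ∑ (vecs bit d) (λ S → G S ^ 2)          ≡⟨ N*testSum-𝟎 1 ⟨
    N * testSum 1 𝟎                         ≡⟨ cong (N *_) testSum-1 ⟩
    N * N                                   ∎
    where
    open ≡-Reasoning
    -- With a single sample the test compares `f x` with itself, so every term is 1.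
    testSum-1 : testSum 1 𝟎 ≡ N
    testSum-1 = trans (testSum-suc 0 𝟎) (trans
      (∑-cong (vecs bit d) (λ x → trans
        (cong (F x *_) (trans (testSum-zero (𝟎 ⊕ x))
          (cong F (trans (zipWith-identityʳ xor-identityʳ (𝟎 ⊕ x)) (zipWith-identityˡ xor-identityˡ x)))))
        (sign-square (f x))))
      (trans (∑-const (vecs bit d) 1ℤ) (ℤ.*-identityʳ N)))

  G²≤N² : ∀ S → G S * G S ℤ.≤ N * N
  G²≤N² S = subst (G S * G S ℤ.≤_) parseval
    (term≤∑ (λ S → square-nonNeg (G S)) (vecs-complete bit S))

  -- One factor `G S * G S` is kept for Parseval and the other `m` are bounded by `N * N`.
  ∑G^even≤ : ∀ m → ∑ (vecs bit d) (λ S → G S ^ (suc m ℕ.* 2)) ℤ.≤ N ^ (suc m ℕ.* 2)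
  ∑G^even≤ m = begin
    ∑ (vecs bit d) (λ S → G S ^ (suc m ℕ.* 2))          ≡⟨ ∑-cong (vecs bit d) (λ S → ^-even (G S) (suc m)) ⟩
    ∑ (vecs bit d) (λ S → G S * G S * (G S * G S) ^ m)  ≤⟨ ∑-mono-≤ (vecs bit d) (λ S → *-mono-≤-nonNeg (square-nonNeg (G S)) (^-nonNeg (square-nonNeg (G S)) m) ℤ.≤-refl (^-monoˡ-≤-nonNeg (square-nonNeg (G S)) (G²≤N² S) m)) ⟩
    ∑ (vecs bit d) (λ S → G S * G S * (N * N) ^ m)      ≡⟨ ∑-cong (vecs bit d) (λ S → ℤ.*-comm (G S * G S) _) ⟩
    ∑ (vecs bit d) (λ S → (N * N) ^ m * (G S * G S))    ≡⟨ ∑-*ˡ (vecs bit d) ((N * N) ^ m) _ ⟩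
    (N * N) ^ m * ∑ (vecs bit d) (λ S → G S * G S)      ≡⟨ cong ((N * N) ^ m *_) parseval ⟩
    (N * N) ^ m * (N * N)                               ≡⟨ ℤ.*-comm _ (N * N) ⟩
    (N * N) ^ suc m                                     ≡⟨ ^-even N (suc m) ⟨
    N ^ (suc m ℕ.* 2)                                   ∎
    where open ≤-Reasoning

  ∑G^even≥ : (∀ S → G S ℤ.< 0ℤ) → ∀ m → N ^ (m ℕ.* 2) ℤ.≤ ∑ (vecs bit d) (λ S → G S ^ (m ℕ.* 2))
  ∑G^even≥ G<0 m = begin
    N ^ (m ℕ.* 2)                               ≡⟨ ^-even N m ⟩
    (N * N) ^ m                                 ≤⟨ ^-monoˡ-≤-nonNeg (square-nonNeg N) N²≤G² m ⟩
    -- A single term suffices, all terms being nonnegative; `𝟎` is just a convenient index.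
    (G 𝟎 * G 𝟎) ^ m                             ≤⟨ term≤∑ (λ S → ^-nonNeg (square-nonNeg (G S)) m) (vecs-complete bit 𝟎) ⟩
    ∑ (vecs bit d) (λ S → (G S * G S) ^ m)      ≡⟨ ∑-cong (vecs bit d) (λ S → sym (^-even (G S) m)) ⟩
    ∑ (vecs bit d) (λ S → G S ^ (m ℕ.* 2))      ∎
    where
    open ≤-Reasoning

    -- Zero only if `G S` is 0 or `- N`, and `G<0` excludes 0. The defects are nonnegative with sum
    -- at most 0, which forces each to vanish.
    defect : Subset d → ℤ
    defect S = - G S * (G S + N)

    defect≥0 : ∀ S → 0ℤ ℤ.≤ defect S
    defect≥0 S = *-nonNeg (ℤ.neg-mono-≤ (ℤ.<⇒≤ (G<0 S)))
      (subst (ℤ._≤ G S + N) (ℤ.+-inverseˡ N) (ℤ.+-monoˡ-≤ N (-N≤G S)))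

    ∑defect≤0 : ∑ (vecs bit d) defect ℤ.≤ 0ℤ
    ∑defect≤0 = begin
      ∑ (vecs bit d) defect
        ≡⟨ ∑-cong (vecs bit d) (λ S → expand (G S) N) ⟩
      ∑ (vecs bit d) (λ S → -1ℤ * (G S * G S) + - N * G S)
        ≡⟨ ∑-+ (vecs bit d) _ _ ⟩
      ∑ (vecs bit d) (λ S → -1ℤ * (G S * G S)) + ∑ (vecs bit d) (λ S → - N * G S)
        ≡⟨ cong₂ _+_ (trans (∑-*ˡ (vecs bit d) -1ℤ _) (cong (-1ℤ *_) parseval)) (trans (∑-*ˡ (vecs bit d) (- N) G) (cong (- N *_) ∑G)) ⟩
      -1ℤ * (N * N) + - N * (N * F 𝟎)
        ≡⟨ collect N (F 𝟎) ⟩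
      -- Parseval and `∑G` have evaluated the sum; its sign follows from `F 𝟎` being at least -1.
      - ((N * N) * (F 𝟎 + 1ℤ))
        ≤⟨ ℤ.neg-mono-≤ (*-nonNeg (square-nonNeg N) (ℤ.+-monoˡ-≤ 1ℤ (-1≤sign (f 𝟎)))) ⟩
      0ℤ ∎
      where
      expand : ∀ g n → - g * (g + n) ≡ -1ℤ * (g * g) + - n * g
      expand = solve-∀
      collect : ∀ n s → -1ℤ * (n * n) + - n * (n * s) ≡ - ((n * n) * (s + 1ℤ))
      collect = solve-∀

    G+N≤0 : G 𝟎 + N ℤ.≤ 0ℤ
    G+N≤0 = ℤ.*-cancelˡ-≤-pos (G 𝟎 + N) 0ℤ (- G 𝟎) {{ℤ.positive (ℤ.neg-mono-< (G<0 𝟎))}}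
      (subst (defect 𝟎 ℤ.≤_) (sym (ℤ.*-zeroʳ (- G 𝟎)))
        (ℤ.≤-trans (term≤∑ defect≥0 (vecs-complete bit 𝟎)) ∑defect≤0))

    N≤-G : N ℤ.≤ - G 𝟎
    N≤-G = ℤ.0≤i-j⇒j≤i (subst (0ℤ ℤ.≤_) (negate (G 𝟎) N) (ℤ.neg-mono-≤ G+N≤0))
      where
      negate : ∀ g n → - (g + n) ≡ - g - n
      negate = solve-∀

    N²≤G² : N * N ℤ.≤ G 𝟎 * G 𝟎
    N²≤G² = subst (N * N ℤ.≤_) (square-neg (G 𝟎))
      (*-mono-≤-nonNeg (ℤ.≤-trans (ℤ.+≤+ ℕ.z≤n) N≤-G) (ℤ.+≤+ ℕ.z≤n) N≤-G N≤-G)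
      where
      square-neg : ∀ g → - g * - g ≡ g * g
      square-neg = solve-∀

  -- The bound β/q on each normalised coefficient passes to the whole test: it replaces one of the
  -- `k + 1` factors `G S`, and the remaining even power sum is compared with `N ^ k`.
  testSum-bound : ∀ q β .{{_ : Positive q}} → (∀ S → q * G S ℤ.≤ β * N) →
    ∀ m → q * testSum (suc m ℕ.* 2) 𝟎 ℤ.≤ β * N ^ (suc m ℕ.* 2)
  testSum-bound q β qG≤βN m = ℤ.*-cancelˡ-≤-pos _ _ N {{N-pos}} (begin
    N * (q * testSum k 𝟎)                           ≡⟨ *-exchange N q _ ⟩
    q * (N * testSum k 𝟎)                           ≡⟨ cong (q *_) (N*testSum-𝟎 k) ⟩
    q * ∑ (vecs bit d) (λ S → G S ^ suc k)          ≡⟨ ∑-*ˡ (vecs bit d) q _ ⟨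
    ∑ (vecs bit d) (λ S → q * (G S * G S ^ k))      ≡⟨ ∑-cong (vecs bit d) (λ S → sym (ℤ.*-assoc q (G S) (G S ^ k))) ⟩
    -- Evenness of `k` enters here: multiplying by `G S ^ k` keeps the direction of the inequality
    -- even when `G S` is negative.
    ∑ (vecs bit d) (λ S → q * G S * G S ^ k)        ≤⟨ ∑-mono-≤ (vecs bit d) (λ S → ℤ.*-monoʳ-≤-nonNeg (G S ^ k) {{ℤ.nonNegative (G^k≥0 S)}} (qG≤βN S)) ⟩
    ∑ (vecs bit d) (λ S → β * N * G S ^ k)          ≡⟨ ∑-*ˡ (vecs bit d) (β * N) _ ⟩
    β * N * P                                       ≡⟨ regroup β N P ⟩
    N * (β * P)                                     ≤⟨ ℤ.*-monoˡ-≤-nonNeg N β*P≤β*N^k ⟩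
    N * (β * N ^ k)                                 ∎)
    where
    open ≤-Reasoning
    k = suc m ℕ.* 2
    P = ∑ (vecs bit d) (λ S → G S ^ k)

    regroup : ∀ a b c → a * b * c ≡ b * (a * c)
    regroup = solve-∀

    N-pos : Positive N
    N-pos = ℤ.positive (ℤ.+<+ (ℕ.>-nonZero⁻¹ _ {{length-nonZero (cube d)}}))

    G^k≥0 : ∀ S → 0ℤ ℤ.≤ G S ^ k
    G^k≥0 S = subst (0ℤ ℤ.≤_) (sym (^-even (G S) (suc m))) (^-nonNeg (square-nonNeg (G S)) (suc m))

    β*P≤β*N^k : β * P ℤ.≤ β * N ^ k
    -- A negative β reverses the comparison, so that case calls for the lower bound on `P`; it also
    -- makes every `G S` negative, as that bound requires.
    β*P≤β*N^k with 0ℤ ℤ.≤? β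
    ... | yes 0≤β = ℤ.*-monoˡ-≤-nonNeg β {{ℤ.nonNegative 0≤β}} (∑G^even≤ m)
    ... | no 0≰β = ℤ.*-monoˡ-≤-nonPos β {{ℤ.nonPositive (ℤ.<⇒≤ β<0)}} (∑G^even≥ G<0 (suc m))
      where
      β<0 : β ℤ.< 0ℤ
      β<0 = ℤ.≰⇒> 0≰β
      qG<q0 : ∀ S → q * G S ℤ.< q * 0ℤ
      qG<q0 S = begin-strict
        q * G S   ≤⟨ qG≤βN S ⟩
        β * N     <⟨ ℤ.*-monoʳ-<-pos N {{N-pos}} β<0 ⟩
        0ℤ        ≡⟨ ℤ.*-zeroʳ q ⟨
        q * 0ℤ    ∎
      G<0 : ∀ S → G S ℤ.< 0ℤ
      G<0 S = ℤ.*-cancelˡ-<-nonNeg q {{ℤ.nonNegative (ℤ.<⇒≤ (ℤ.positive⁻¹ q))}} (qG<q0 S)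

theorem1p2 : ∀ (k d : ℕ) → 2 ℕ.≤ k → 2 ∣ k → ∀ (ε : ℚ) (f : Cube d → Bool) → FarFromLinear ε f →
    ε ≤ Pr (power (cube d) k) (λ xs → ¬? (sum₂ (map f xs) ≟ f (⨁ xs)))
theorem1p2 .(zero ℕ.* 2)  d () (divides zero refl)    ε f far
theorem1p2 .(suc m ℕ.* 2) d _  (divides (suc m) refl) ε@record{} f far =
  correlation≤⇒≤Pr (power (cube d) k) (λ xs → sum₂ (map f xs)) (λ xs → f (⨁ xs)) ε (begin
    ↧ ε * ∑ (vecs (cube d) k) (λ xs → sign (sum₂ (map f xs) xor f (⨁ xs)))
      -- Inserts the zero shift at which `testSum` is evaluated.
      ≡⟨ cong (↧ ε *_) (∑-cong (vecs (cube d) k) (λ xs →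
           cong (λ z → sign (sum₂ (map f xs) xor f z)) (sym (zipWith-identityˡ xor-identityˡ (⨁ xs))))) ⟩
    ↧ ε * testSum f k (replicate d false)
      ≤⟨ testSum-bound f (↧ ε) β coefficient≤ m ⟩
    β * card d ^ k
      ≡⟨ cong (β *_) (length-vecs (cube d) k) ⟨
    β * + length (vecs (cube d) k) ∎)
  where
  open ≤-Reasoning
  k = suc m ℕ.* 2
  -- 1 - 2ε scaled by the denominator of ε, matching the factor `↧ ε` on the other side.
  β = ↧ ε - + 2 * ↥ ε
  coefficient≤ : ∀ S → ↧ ε * G f S ℤ.≤ β * card d
  coefficient≤ S = subst (λ z → ↧ ε * z ℤ.≤ β * card d) (sym (G≡correlation f S))
    (≤Pr⇒correlation≤ (cube d) f (sumOver S) ε (far (sumOver S) (S , λ _ → refl)))
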